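{- Let $\mathcal{L}_{\rm TM}$ be the Thue–Morse language and let ${\rm S}:\mathcal{L}_{\rm TM}\to\mathbb{N}$ be a homomorphism. Put $p={\rm S}(a)$, $q={\rm S}(b)$. Then $${\rm S}(\mathcal{L}_{\rm TM})=\big(R_{p+q,0}\cup R_{p+q,p}\cup R_{p+q,q}\cup R_{p+q,2p}\cup R_{p+q,2q}\big)\setminus\{0\}.$$
   Context: $\mathbb{N}=\{1,2,3,\dots\}$. Let $\theta$ be the Thue–Morse morphism on $\{a,b\}$, $\theta(a)=ab$, $\theta(b)=ba$. The Thue–Morse language $\mathcal{L}_{\rm TM}$ is the set of all nonempty finite words occurring as factors of $\theta^n(a)$ for some $n\ge0$ (equivalently, of the infinite Thue–Morse word $\theta^\infty(a)=abbabaab\cdots$). A homomorphism ${\rm S}:\mathcal{L}_{\rm TM}\to\mathbb{N}$ is a map with ${\rm S}(w_1\cdots w_n)={\rm S}(w_1)+\cdots+{\rm S}(w_n)$, determined by ${\rm S}(a),{\rm S}(b)\in\mathbb{N}$. For integers $r\ge1$, $s\ge0$, $R_{r,s}=\{s,\ r+s,\ 2r+s,\dots\}=\{rn+s: n\ge0\}$. -}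

module Defs where

open import Data.List.Base using (List; []; _∷_; [_]; concatMap; map)
open import Data.List.Relation.Binary.Infix.Heterogeneous using (Infix; here; there)
open import Data.List.Relation.Binary.Prefix.Heterogeneous using ([]; _∷_)
open import Data.Nat.Base using (ℕ; _+_; _*_; _<_)
open import Data.Nat.GeneralisedArithmetic using (fold)
open import Data.Nat.ListAction using (sum)
open import Data.Product.Base using (_×_; _,_; Σ-syntax; ∃-syntax)
open import Level using (0ℓ)
open import Relation.Binary.PropositionalEquality using (_≡_; _≢_; refl)
open import Relation.Unary using (Pred; _∈_)

data Letter : Set where
  a b : Letter

Word : Set
Word = List Letter

θ-letter : Letter → Word
θ-letter a = a ∷ b ∷ []
θ-letter b = b ∷ a ∷ []

θ : Word → Word
θ = concatMap θ-letter

θ^_[a] : ℕ → Word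
θ^ n [a] = fold [ a ] θ n

-- Infix _≡_ w x says that w is a contiguous factor of x.
𝓛TM : Pred Word 0ℓ
𝓛TM w = w ≢ [] × ∃[ n ] Infix _≡_ w (θ^ n [a])

letter∈𝓛TM : ∀ x → [ x ] ∈ 𝓛TM
letter∈𝓛TM a = (λ ()) , 0 , here (refl ∷ [])
letter∈𝓛TM b = (λ ()) , 1 , there (here (refl ∷ []))

-- A homomorphism from 𝓛TM to the positive integers. The value S w w∈𝓛 cannot
-- depend on the membership proof, since the right-hand side of homo does not.
record Homomorphism : Set where
  field
    S        : ∀ w → w ∈ 𝓛TM → ℕ
    positive : ∀ w (w∈𝓛 : w ∈ 𝓛TM) → 0 < S w w∈𝓛
    homo     : ∀ w (w∈𝓛 : w ∈ 𝓛TM) →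
               S w w∈𝓛 ≡ sum (map (λ x → S [ x ] (letter∈𝓛TM x)) w)

  S-letter : Letter → ℕ
  S-letter x = S [ x ] (letter∈𝓛TM x)

  image : Pred ℕ 0ℓ
  image m = ∃[ w ] Σ[ w∈𝓛 ∈ w ∈ 𝓛TM ] S w w∈𝓛 ≡ m

R : ℕ → ℕ → Pred ℕ 0ℓ
R r s m = ∃[ n ] m ≡ r * n + s

{-# OPTIONS --safe #-}
-- Cutting a factor of a θ-image at the block boundaries writes it as l θ(v) r
-- with l and r empty or single letters, and such a word has weight
-- S(l) + |v| (p + q) + S(r); this gives the inclusion ⊆.
-- Conversely, for all letters c, d and every k there is a word c v d in the
-- language with |v| = k. For k > 0, halve k: from c v d one gets
-- c c̄ θ(v) d, with gap 2|v| + 1, and from c̄ v d one gets c θ(v) d, with gap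
-- 2|v|. The latter construction also realises every weight on the right-hand
-- side.
module Submission where

open import Defs
open import Data.Fin.Base using (zero; suc)
open import Data.List.Base using ([]; _∷_; [_]; _++_; length; map; fromMaybe)
open import Data.List.Properties using (concatMap-++; map-++)
open import Data.List.Relation.Binary.Infix.Heterogeneous using (Infix; here; there; _++ⁱ_; _ⁱ++_)
import Data.List.Relation.Binary.Infix.Heterogeneous.Properties as Infixₚ
import Data.List.Relation.Binary.Pointwise as Pointwise
open import Data.List.Relation.Binary.Prefix.Heterogeneous using (Prefix; []; _∷_)
import Data.List.Relation.Binary.Prefix.Heterogeneous.Properties as Prefixₚ
open import Data.Maybe.Base using (Maybe; just; nothing; maybe)
open import Data.Nat.Base using (ℕ; zero; suc; _+_; _*_; _<_; s≤s; z≤n)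
open import Data.Nat.DivMod using (result; _divMod_)
open import Data.Nat.Induction using (<-rec)
open import Data.Nat.ListAction using (sum)
open import Data.Nat.ListAction.Properties using (sum-++)
open import Data.Nat.Properties using (+-identityʳ; +-assoc; m<m*n; m≤m*n; <⇒≢)
open import Data.Nat.Tactic.RingSolver using (solve-∀)
open import Data.Product.Base using (_×_; _,_; ∃-syntax)
open import Data.Sum.Base using (inj₁; inj₂)
open import Function.Base using (id)
open import Relation.Binary.PropositionalEquality using (_≡_; refl; sym; trans; cong; cong₂; subst; module ≡-Reasoning)
open import Relation.Unary using (_∪_; _∖_; ｛_｝; _≐_; _∈_)

-- The morphism and factors of its iterates.

complement : Letter → Letter
complement a = b
complement b = a

complement-involutive : ∀ c → complement (complement c) ≡ c
complement-involutive a = refl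
complement-involutive b = refl

θ-∷ : ∀ c w → θ (c ∷ w) ≡ c ∷ complement c ∷ θ w
θ-∷ a w = refl
θ-∷ b w = refl

length-θ : ∀ w → length (θ w) ≡ length w * 2
length-θ []      = refl
length-θ (a ∷ w) = cong (2 +_) (length-θ w)
length-θ (b ∷ w) = cong (2 +_) (length-θ w)

Prefix-θ : ∀ {u x} → Prefix _≡_ u x → Prefix _≡_ (θ u) (θ x)
Prefix-θ []           = []
Prefix-θ (refl ∷ pre) = Prefixₚ.++⁺ (Pointwise.refl refl) (Prefix-θ pre)

Infix-θ : ∀ {u x} → Infix _≡_ u x → Infix _≡_ (θ u) (θ x)
Infix-θ (here pre)          = here (Prefix-θ pre)
Infix-θ (there {b = c} inf) = θ-letter c ++ⁱ Infix-θ inf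

-- Membership in the language without nonemptiness, so that empty pieces need no separate treatment;
-- nonemptiness returns only at the very end.
Factor : Word → Set
Factor w = ∃[ n ] Infix _≡_ w (θ^ n [a])

Factor-θ : ∀ {w} → Factor w → Factor (θ w)
Factor-θ (n , inf) = suc n , Infix-θ inf

Factor-infix : ∀ {w u} → Infix _≡_ w u → Factor u → Factor w
Factor-infix inf (n , inf′) = n , Infixₚ.trans trans inf inf′

-- Cutting factors at block boundaries.

factor⇒factor-of-θ-image : ∀ {w} → Factor w → ∃[ u ] Infix _≡_ w (θ u)
-- The one-letter iterate is no `θ`-image itself, but it is a prefix of `θ [ a ]`, the word ab.
factor⇒factor-of-θ-image (zero  , inf) = [ a ] , inf ⁱ++ [ b ]
factor⇒factor-of-θ-image (suc n , inf) = θ^ n [a] , inf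

prefix-of-θ : ∀ {w} u → Prefix _≡_ w (θ u) →
              ∃[ v ] ∃[ r ] w ≡ θ v ++ fromMaybe r
prefix-of-θ []      []          = [] , nothing , refl
prefix-of-θ (a ∷ u) []          = [] , nothing , refl
prefix-of-θ (b ∷ u) []          = [] , nothing , refl
prefix-of-θ (a ∷ u) (refl ∷ []) = [] , just a , refl
prefix-of-θ (b ∷ u) (refl ∷ []) = [] , just b , refl
prefix-of-θ (a ∷ u) (refl ∷ refl ∷ pre) with prefix-of-θ u pre
... | v , r , refl = a ∷ v , r , refl
prefix-of-θ (b ∷ u) (refl ∷ refl ∷ pre) with prefix-of-θ u pre
... | v , r , refl = b ∷ v , r , refl

-- An occurrence starts at a block boundary, at the second letter of the first block, which then
-- becomes `l`, or beyond that block, where the recursion continues.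
infix-of-θ : ∀ {w} u → Infix _≡_ w (θ u) →
             ∃[ l ] ∃[ v ] ∃[ r ] w ≡ fromMaybe l ++ θ v ++ fromMaybe r
infix-of-θ []      (here pre)          = nothing , prefix-of-θ [] pre
infix-of-θ (a ∷ u) (here pre)          = nothing , prefix-of-θ (a ∷ u) pre
infix-of-θ (b ∷ u) (here pre)          = nothing , prefix-of-θ (b ∷ u) pre
infix-of-θ (a ∷ u) (there (there inf)) = infix-of-θ u inf
infix-of-θ (b ∷ u) (there (there inf)) = infix-of-θ u inf
infix-of-θ (a ∷ u) (there (here []))   = nothing , [] , nothing , refl
infix-of-θ (b ∷ u) (there (here []))   = nothing , [] , nothing , refl
infix-of-θ (a ∷ u) (there (here (refl ∷ pre))) with prefix-of-θ u pre
... | v , r , refl = just b , v , r , refl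
infix-of-θ (b ∷ u) (there (here (refl ∷ pre))) with prefix-of-θ u pre
... | v , r , refl = just a , v , r , refl

-- Factors with prescribed end letters and gap.

FactorWithEnds : ℕ → Letter → Letter → Set
FactorWithEnds k c d = ∃[ v ] length v ≡ k × Factor (c ∷ v ++ [ d ])

-- The image of c v d is c c̄ θ(v) d d̄; its last letter is cut off.
θ-ends : ∀ c v d → Factor (c ∷ v ++ [ d ]) →
         Factor (c ∷ complement c ∷ θ v ++ [ d ])
θ-ends c v d fac = Factor-infix (here pre) (subst Factor eq (Factor-θ fac))
  where
  open ≡-Reasoning
  eq : θ (c ∷ v ++ [ d ]) ≡ c ∷ complement c ∷ θ v ++ d ∷ complement d ∷ []
  eq = begin
    θ (c ∷ v ++ [ d ])
      ≡⟨ θ-∷ c (v ++ [ d ]) ⟩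
    c ∷ complement c ∷ θ (v ++ [ d ])
      ≡⟨ cong (λ w → c ∷ complement c ∷ w) (concatMap-++ θ-letter v [ d ]) ⟩
    c ∷ complement c ∷ θ v ++ θ [ d ]
      ≡⟨ cong (λ w → c ∷ complement c ∷ θ v ++ w) (θ-∷ d []) ⟩
    c ∷ complement c ∷ θ v ++ d ∷ complement d ∷ [] ∎
  pre : Prefix _≡_ (c ∷ complement c ∷ θ v ++ [ d ])
                   (c ∷ complement c ∷ θ v ++ d ∷ complement d ∷ [])
  pre = refl ∷ refl ∷ Prefixₚ.++⁺ (Pointwise.refl refl) (refl ∷ [])

θ-inner-ends : ∀ c v d → Factor (complement c ∷ v ++ [ d ]) →
               Factor (c ∷ θ v ++ [ d ])
θ-inner-ends c v d fac =
  subst (λ x → Factor (x ∷ θ v ++ [ d ])) (complement-involutive c)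
    (Factor-infix (there (Infixₚ.fromPointwise (Pointwise.refl refl)))
      (θ-ends (complement c) v d fac))

-- Halving does not decrease gap 0, so the base case is explicit: ab occurs in ab, both ba and bb in
-- abba, and aa only from abbabaab on.
adjacent : ∀ c d → FactorWithEnds 0 c d
adjacent a a = [] , refl , 3 , there (there (there (there (there (here (refl ∷ refl ∷ []))))))
adjacent a b = [] , refl , 1 , here (refl ∷ refl ∷ [])
adjacent b a = [] , refl , 2 , there (there (here (refl ∷ refl ∷ [])))
adjacent b b = [] , refl , 2 , there (here (refl ∷ refl ∷ []))

-- Strong induction on the gap. The end letters stay quantified in the hypothesis, because an even
-- gap calls it with the first letter complemented.
factorWithEnds : ∀ k c d → FactorWithEnds k c d
factorWithEnds = <-rec (λ k → ∀ c d → FactorWithEnds k c d) step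
  where
  step : ∀ k → (∀ {j} → j < k → ∀ c d → FactorWithEnds j c d) →
         ∀ c d → FactorWithEnds k c d
  step k rec c d with k divMod 2
  ... | result zero zero refl = adjacent c d
  ... | result (suc j) zero refl
    with v , ∣v∣≡ , fac ← rec (m<m*n (suc j) 2 (s≤s (s≤s z≤n))) (complement c) d
    = θ v , trans (length-θ v) (cong (_* 2) ∣v∣≡) , θ-inner-ends c v d fac
  -- The odd unit of the gap is the second letter of the block of `c`, which is kept here.
  ... | result j (suc zero) refl
    with v , refl , fac ← rec (s≤s (m≤m*n j 2)) c d
    = complement c ∷ θ v , cong suc (length-θ v) , θ-ends c v d fac

-- An absent end letter is realised by an arbitrary one, here a, and cut off.
endLetter : Maybe Letter → Letter
endLetter = maybe id a

shrink-ends : ∀ l w r → Infix _≡_ (fromMaybe l ++ w ++ fromMaybe r)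
                                  (endLetter l ∷ w ++ [ endLetter r ])
shrink-ends l w r = left l
  where
  right : ∀ r → Prefix _≡_ (fromMaybe r) [ endLetter r ]
  right (just d) = refl ∷ []
  right nothing  = []

  pre : Prefix _≡_ (w ++ fromMaybe r) (w ++ [ endLetter r ])
  pre = Prefixₚ.++⁺ (Pointwise.refl refl) (right r)

  left : ∀ l → Infix _≡_ (fromMaybe l ++ w ++ fromMaybe r)
                         (endLetter l ∷ w ++ [ endLetter r ])
  left (just c) = here (refl ∷ pre)
  left nothing  = there (here pre)

-- Converse to `infix-of-θ`: every choice of ends and every number of blocks does occur.
factor-with-blocks : ∀ l k r →
  ∃[ v ] length v ≡ k × Factor (fromMaybe l ++ θ v ++ fromMaybe r)
factor-with-blocks l k r
  with v , eq , fac ← factorWithEnds k (complement (endLetter l)) (endLetter r)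
  = v , eq , Factor-infix (shrink-ends l (θ v) r)
               (θ-inner-ends (endLetter l) v (endLetter r) fac)

-- Weights of words and the five progressions.

module Weight (f : Letter → ℕ) where

  p q : ℕ
  p = f a
  q = f b

  -- For `f` equal to `S-letter`, this extends `S` to all words; by `homo` the two agree on the
  -- language.
  weight : Word → ℕ
  weight w = sum (map f w)

  weightᴹ : Maybe Letter → ℕ
  weightᴹ = maybe f 0

  weight-++ : ∀ u v → weight (u ++ v) ≡ weight u + weight v
  weight-++ u v = trans (cong sum (map-++ f u v)) (sum-++ (map f u) (map f v))

  weight-fromMaybe : ∀ l → weight (fromMaybe l) ≡ weightᴹ l
  weight-fromMaybe (just c) = +-identityʳ (f c)
  weight-fromMaybe nothing  = refl

  -- Each block is ab or ba and weighs `p + q` in either order.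
  weight-θ : ∀ v → weight (θ v) ≡ length v * (p + q)
  weight-θ []      = refl
  weight-θ (a ∷ v) = trans (cong (λ n → p + (q + n)) (weight-θ v)) (sym (+-assoc p q _))
  weight-θ (b ∷ v) = trans (cong (λ n → q + (p + n)) (weight-θ v)) (swap p q _)
    where
    swap : ∀ x y n → y + (x + n) ≡ x + y + n
    swap = solve-∀

  weight-blocks : ∀ l v r → weight (fromMaybe l ++ θ v ++ fromMaybe r) ≡
                            (p + q) * length v + (weightᴹ l + weightᴹ r)
  weight-blocks l v r = begin
    weight (fromMaybe l ++ θ v ++ fromMaybe r)
      ≡⟨ weight-++ (fromMaybe l) _ ⟩
    weight (fromMaybe l) + weight (θ v ++ fromMaybe r)
      ≡⟨ cong₂ _+_ (weight-fromMaybe l) (weight-++ (θ v) _) ⟩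
    weightᴹ l + (weight (θ v) + weight (fromMaybe r))
      ≡⟨ cong (weightᴹ l +_) (cong₂ _+_ (weight-θ v) (weight-fromMaybe r)) ⟩
    weightᴹ l + (length v * (p + q) + weightᴹ r)
      ≡⟨ regroup (weightᴹ l) (length v) (p + q) (weightᴹ r) ⟩
    (p + q) * length v + (weightᴹ l + weightᴹ r) ∎
    where
    open ≡-Reasoning
    regroup : ∀ x n s y → x + (n * s + y) ≡ s * n + (x + y)
    regroup = solve-∀

  2*-double : ∀ x → 2 * x ≡ x + x
  2*-double = solve-∀

  Residues : ℕ → Set
  Residues = R (p + q) 0 ∪ R (p + q) p ∪ R (p + q) q ∪ R (p + q) (2 * p) ∪ R (p + q) (2 * q)

  blocks∈Residues : ∀ n l r → (p + q) * n + (weightᴹ l + weightᴹ r) ∈ Residues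
  blocks∈Residues n nothing  nothing  = inj₁ (n , refl)
  blocks∈Residues n nothing  (just a) = inj₂ (inj₁ (n , refl))
  blocks∈Residues n nothing  (just b) = inj₂ (inj₂ (inj₁ (n , refl)))
  blocks∈Residues n (just a) nothing  =
    inj₂ (inj₁ (n , cong ((p + q) * n +_) (+-identityʳ p)))
  blocks∈Residues n (just b) nothing  =
    inj₂ (inj₂ (inj₁ (n , cong ((p + q) * n +_) (+-identityʳ q))))
  blocks∈Residues n (just a) (just a) =
    inj₂ (inj₂ (inj₂ (inj₁ (n , cong ((p + q) * n +_) (sym (2*-double p))))))
  blocks∈Residues n (just b) (just b) =
    inj₂ (inj₂ (inj₂ (inj₂ (n , cong ((p + q) * n +_) (sym (2*-double q))))))
  -- Two different end letters together weigh as much as one more block.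
  blocks∈Residues n (just a) (just b) = inj₁ (suc n , carry p q n)
    where
    carry : ∀ x y n → (x + y) * n + (x + y) ≡ (x + y) * suc n + 0
    carry = solve-∀
  blocks∈Residues n (just b) (just a) = inj₁ (suc n , carry p q n)
    where
    carry : ∀ x y n → (x + y) * n + (y + x) ≡ (x + y) * suc n + 0
    carry = solve-∀

  weight∈Residues : ∀ {w} → Factor w → weight w ∈ Residues
  weight∈Residues fac
    with u , inf ← factor⇒factor-of-θ-image fac
    with l , v , r , refl ← infix-of-θ u inf
    = subst Residues (sym (weight-blocks l v r)) (blocks∈Residues (length v) l r)

  attained : ∀ l r n → ∃[ w ] Factor w × weight w ≡ (p + q) * n + (weightᴹ l + weightᴹ r)
  attained l r n with v , refl , fac ← factor-with-blocks l n r
    = _ , fac , weight-blocks l v r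

  Residues-attained : ∀ {m} → m ∈ Residues → ∃[ w ] Factor w × weight w ≡ m
  Residues-attained (inj₁ (n , refl)) = attained nothing nothing n
  Residues-attained (inj₂ (inj₁ (n , refl))) = attained nothing (just a) n
  Residues-attained (inj₂ (inj₂ (inj₁ (n , refl)))) = attained nothing (just b) n
  Residues-attained (inj₂ (inj₂ (inj₂ (inj₁ (n , refl)))))
    rewrite 2*-double p = attained (just a) (just a) n
  Residues-attained (inj₂ (inj₂ (inj₂ (inj₂ (n , refl)))))
    rewrite 2*-double q = attained (just b) (just b) n

theorem7 : (𝑺 : Homomorphism) →
    let open Homomorphism 𝑺
        p = S-letter a
        q = S-letter b
    in image ≐ ((R (p + q) 0 ∪ R (p + q) p ∪ R (p + q) q ∪ R (p + q) (2 * p) ∪ R (p + q) (2 * q)) ∖ ｛ 0 ｝)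
theorem7 𝑺 = image⊆ , ⊆image
  where
  open Homomorphism 𝑺
  open Weight S-letter

  image⊆ : ∀ {m} → m ∈ image → m ∈ (Residues ∖ ｛ 0 ｝)
  image⊆ (w , w∈𝓛@(_ , fac) , refl) =
    subst Residues (sym (homo w w∈𝓛)) (weight∈Residues fac) , <⇒≢ (positive w w∈𝓛)

  ⊆image : ∀ {m} → m ∈ (Residues ∖ ｛ 0 ｝) → m ∈ image
  ⊆image (m∈ , 0≢m) with w , fac , refl ← Residues-attained m∈
    = w , w∈𝓛 , homo w w∈𝓛
    where
    w∈𝓛 : w ∈ 𝓛TM
    -- The empty word has weight 0, which is the excluded value.
    w∈𝓛 = (λ { refl → 0≢m refl }) , fac
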